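{- Let $q$ be a prime power, let $m,n$ be positive integers, and let $X$ be a vector space over $\mathbb{F}_q$ of dimension $mn\ge 2$. Let $\mathcal{A}$ be a partial $m$-spread of $X$, let $h$ be a positive integer with $1\leq h\leq m$, and let $U$ be an $\mathbb{F}_q$-subspace of $X$. If $U$ is $(\mathcal{A},h)$-evasive, then $$\dim_{\mathbb{F}_q}(U)\leq m(n-1)+h.$$ Furthermore, equality is possible only if $|\mathcal{A}|\leq q^{m(n-1)}$. In particular, if $\mathcal{A}$ is an $m$-spread of $X$, then $$\dim_{\mathbb{F}_q}(U)\leq m(n-1)+h-1.$$
   Context: A collection $\mathcal{A}$ of $m$-dimensional $\mathbb{F}_q$-subspaces of $X$ is a partial $m$-spread if $S\cap S'=\{0\}$ for all distinct $S,S'\in\mathcal{A}$; it is an $m$-spread if moreover every non-zero vector of $X$ lies in exactly one element of $\mathcal{A}$. An $\mathbb{F}_q$-subspace $U\le X$ is $(\mathcal{A},h)$-evasive if $\dim_{\mathbb{F}_q}(U\cap S)\leq h$ for all $S\in\mathcal{A}$.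
   Formalization: The collection A is taken non-empty; the equality clause is stated only for h < m or n = 1, and the m-spread clause only for h < m and n ≥ 2, since the claims fail otherwise (A empty; U = X when h = m; A = {X} when n = 1). -}

module Defs where

open import Level using (Level; _⊔_) renaming (suc to lsuc)
open import Algebra.Bundles using (CommutativeRing)
open import Algebra.Module.Bundles using (Module)
import Algebra.Properties.AbelianGroup as AbelianGroupProperties
import Algebra.Properties.CommutativeMonoid.Sum as CommutativeMonoidSum
open import Data.Fin.Base using (Fin; zero; suc; finToFun; funToFin)
open import Data.Fin.Properties using (all?; any?; finToFun-funToFin)
  renaming (_≟_ to _≟ᶠ_)
open import Data.List.Base using (List; []; _∷_; allFin)
open import Data.List.Membership.Propositional.Properties using (∈-allFin)
open import Data.List.Relation.Unary.All as All using (All; []; _∷_)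
open import Data.Nat.Base using (ℕ; zero; suc; _≤_; _^_)
open import Data.Nat.Primality using (Prime)
open import Data.Product using (Σ-syntax; ∃; ∃-syntax; ∃!; _×_; _,_; proj₁; proj₂)
import Data.Vec.Functional as Vector
open import Data.Unit.Polymorphic.Base using (tt)
open import Function.Base using (_∘_)
open import Function.Bundles using (Inverse)
open import Relation.Binary.PropositionalEquality as ≡ using (_≡_; _≢_)
open import Relation.Nullary.Decidable as Dec using (Dec; yes; no; _×-dec_)
open import Relation.Nullary.Negation using (¬_; contradiction)
open import Relation.Unary using (Pred; Decidable; _∈_; _∉_; _∩_; _≐_)
open import Relation.Unary.Polymorphic using (U)

IsPrimePower : ℕ → Set
IsPrimePower q = ∃[ p ] ∃[ k ] Prime p × 1 ≤ k × q ≡ p ^ k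

record IsFiniteField {c ℓ} (F : CommutativeRing c ℓ) (q : ℕ) : Set (c ⊔ ℓ) where
  open CommutativeRing F
  field
    0≉1     : ¬ 0# ≈ 1#
    inverse : ∀ x → ¬ x ≈ 0# → ∃[ y ] y * x ≈ 1#
    -- The carrier is a setoid, so "q elements" means q classes of _≈_.
    order   : Inverse setoid (≡.setoid (Fin q))

module LinearAlgebra {c ℓ a ℓa} {F : CommutativeRing c ℓ} (X : Module F a ℓa) where
  open CommutativeRing F using (Carrier; _≈_; 0#)
  open Module X
  open CommutativeMonoidSum +ᴹ-commutativeMonoid using (sum) public

  combination : ∀ {d} → (Fin d → Carrier) → (Fin d → Carrierᴹ) → Carrierᴹ
  combination s v = sum (λ i → s i *ₗ v i)

  Span : ∀ {d} → (Fin d → Carrierᴹ) → Pred Carrierᴹ (c ⊔ ℓa)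
  Span v x = ∃[ s ] x ≈ᴹ combination s v

  Independent : ∀ {d} → (Fin d → Carrierᴹ) → Set (c ⊔ ℓ ⊔ ℓa)
  Independent v = ∀ s → combination s v ≈ᴹ 0ᴹ → ∀ i → s i ≈ 0#

  record IsBasis {p} (W : Pred Carrierᴹ p) {d} (v : Fin d → Carrierᴹ)
         : Set (c ⊔ ℓ ⊔ a ⊔ ℓa ⊔ p) where
    field
      members     : ∀ i → v i ∈ W
      independent : Independent v
      spanning    : ∀ {x} → x ∈ W → x ∈ Span v

HasDimension : ∀ {c ℓ a ℓa} {F : CommutativeRing c ℓ} → Module F a ℓa → ℕ →
               Set (c ⊔ ℓ ⊔ a ⊔ ℓa)
HasDimension {a = a} X N = ∃[ v ] IsBasis (U {ℓ = a}) {N} v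
  where open LinearAlgebra X

module Subspaces {c ℓ a ℓa} {F : CommutativeRing c ℓ} {q : ℕ}
                 (F-field : IsFiniteField F q)
                 {X : Module F a ℓa} {N : ℕ} (X-dim : HasDimension X N) where
  private
    module F = CommutativeRing F
  open F using (Carrier; _≈_; 0#; 1#)
  open Module X
  open LinearAlgebra X
  open IsFiniteField F-field
  open IsBasis

  -- Classically every subset of a finite set is decidable; here decidability
  -- is what makes the dimension of a subspace a well-defined natural number.
  record Subspace p : Set (c ⊔ a ⊔ ℓa ⊔ lsuc p) where
    field
      ⟦_⟧  : Pred Carrierᴹ p
      mem? : Decidable ⟦_⟧
      resp : ∀ {x y} → x ≈ᴹ y → ⟦_⟧ x → ⟦_⟧ y
      0-closed : ⟦_⟧ 0ᴹ
      +-closed : ∀ {x y} → ⟦_⟧ x → ⟦_⟧ y → ⟦_⟧ (x +ᴹ y)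
      *-closed : ∀ s {x} → ⟦_⟧ x → ⟦_⟧ (s *ₗ x)

  open Subspace public using (⟦_⟧)

  infixr 7 _⊓_
  _⊓_ : ∀ {p p′} → Subspace p → Subspace p′ → Subspace (p ⊔ p′)
  V ⊓ W = record
    { ⟦_⟧      = ⟦ V ⟧ ∩ ⟦ W ⟧
    ; mem?     = λ x → V.mem? x ×-dec W.mem? x
    ; resp     = λ x≈y (x∈V , x∈W) → V.resp x≈y x∈V , W.resp x≈y x∈W
    ; 0-closed = V.0-closed , W.0-closed
    ; +-closed = λ (x∈V , x∈W) (y∈V , y∈W) → V.+-closed x∈V y∈V , W.+-closed x∈W y∈W
    ; *-closed = λ s (x∈V , x∈W) → V.*-closed s x∈V , W.*-closed s x∈W
    }
    where
    module V = Subspace V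
    module W = Subspace W

  -- Existence of bases, by decidability of span membership over a finite field.
  module BasisExistence where
    open import Relation.Binary.Reasoning.Setoid ≈ᴹ-setoid
    open AbelianGroupProperties +ᴹ-abelianGroup
      using (inverseˡ-unique)
    module Sum = CommutativeMonoidSum +ᴹ-commutativeMonoid
    module order = Inverse order

    combination-congˡ : ∀ {d} {s t : Fin d → Carrier} (v : Fin d → Carrierᴹ) →
                        (∀ i → s i ≈ t i) → combination s v ≈ᴹ combination t v
    combination-congˡ v s≈t = Sum.sum-cong-≋ (λ i → *ₗ-cong (s≈t i) ≈ᴹ-refl)

    combination-+ : ∀ {d} (s t : Fin d → Carrier) (v : Fin d → Carrierᴹ) →
                    combination (λ i → s i F.+ t i) v ≈ᴹ combination s v +ᴹ combination t v
    combination-+ s t v = ≈ᴹ-trans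
      (Sum.sum-cong-≋ (λ i → *ₗ-distribʳ (v i) (s i) (t i)))
      (Sum.∑-distrib-+ (λ i → s i *ₗ v i) (λ i → t i *ₗ v i))

    combination-* : ∀ {d} r (s : Fin d → Carrier) (v : Fin d → Carrierᴹ) →
                    combination (λ i → r F.* s i) v ≈ᴹ r *ₗ combination s v
    combination-* {zero}  r s v = ≈ᴹ-sym (*ₗ-zeroʳ r)
    combination-* {suc d} r s v = ≈ᴹ-trans
      (+ᴹ-cong (*ₗ-assoc r (s zero) (v zero)) (combination-* r (s ∘ suc) (v ∘ suc)))
      (≈ᴹ-sym (*ₗ-distribˡ r (s zero *ₗ v zero) (combination (s ∘ suc) (v ∘ suc))))

    -1* : ∀ x → (F.- 1#) *ₗ x ≈ᴹ -ᴹ x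
    -1* x = inverseˡ-unique _ _ (begin
      (F.- 1#) *ₗ x +ᴹ x            ≈⟨ +ᴹ-congˡ (*ₗ-identityˡ x) ⟨
      (F.- 1#) *ₗ x +ᴹ 1# *ₗ x      ≈⟨ *ₗ-distribʳ x (F.- 1#) 1# ⟨
      (F.- 1# F.+ 1#) *ₗ x          ≈⟨ *ₗ-cong (F.-‿inverseˡ 1#) ≈ᴹ-refl ⟩
      0# *ₗ x                       ≈⟨ *ₗ-zeroˡ x ⟩
      0ᴹ                            ∎)

    infix 4 _≟_ _≟ᴹ_
    _≟_ : ∀ s t → Dec (s ≈ t)
    s ≟ t = Dec.map′
      (λ e → F.trans (F.sym (order.inverseʳ ≡.refl)) (order.inverseʳ e))
      order.to-cong (order.to s ≟ᶠ order.to t)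

    decode : ∀ {d} → Fin (q ^ d) → Fin d → Carrier
    decode k = order.from ∘ finToFun k

    encode : ∀ {d} → (Fin d → Carrier) → Fin (q ^ d)
    encode s = funToFin (order.to ∘ s)

    decode-encode : ∀ {d} (s : Fin d → Carrier) i → decode (encode s) i ≈ s i
    decode-encode s i = order.inverseʳ (finToFun-funToFin (order.to ∘ s) i)

    b : Fin N → Carrierᴹ
    b = proj₁ X-dim

    coords : ∀ x → x ∈ Span b
    coords x = spanning (proj₂ X-dim) tt

    0? : Decidable (_≈ᴹ 0ᴹ)
    0? x with coords x
    ... | s , x≈ = Dec.map′
      (λ s≈0 → ≈ᴹ-trans x≈ (≈ᴹ-trans
        (Sum.sum-cong-≋ (λ i → ≈ᴹ-trans (*ₗ-cong (s≈0 i) ≈ᴹ-refl) (*ₗ-zeroˡ (b i))))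
        (Sum.sum-replicate-zero N)))
      (λ x≈0 → independent (proj₂ X-dim) s (≈ᴹ-trans (≈ᴹ-sym x≈) x≈0))
      (all? (λ i → s i ≟ 0#))

    _≟ᴹ_ : ∀ x y → Dec (x ≈ᴹ y)
    x ≟ᴹ y = Dec.map′ to from (0? (x +ᴹ -ᴹ y))
      where
      to : x +ᴹ -ᴹ y ≈ᴹ 0ᴹ → x ≈ᴹ y
      to e = begin
        x                    ≈⟨ +ᴹ-identityʳ x ⟨
        x +ᴹ 0ᴹ              ≈⟨ +ᴹ-congˡ (-ᴹ‿inverseˡ y) ⟨
        x +ᴹ (-ᴹ y +ᴹ y)     ≈⟨ +ᴹ-assoc x (-ᴹ y) y ⟨
        (x +ᴹ -ᴹ y) +ᴹ y     ≈⟨ +ᴹ-congʳ e ⟩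
        0ᴹ +ᴹ y              ≈⟨ +ᴹ-identityˡ y ⟩
        y                    ∎
      from : x ≈ᴹ y → x +ᴹ -ᴹ y ≈ᴹ 0ᴹ
      from e = ≈ᴹ-trans (+ᴹ-congʳ e) (-ᴹ‿inverseʳ y)

    Span-resp : ∀ {d} {v : Fin d → Carrierᴹ} {x y} → x ≈ᴹ y → x ∈ Span v → y ∈ Span v
    Span-resp x≈y (s , x≈) = s , ≈ᴹ-trans (≈ᴹ-sym x≈y) x≈

    span? : ∀ {d} (v : Fin d → Carrierᴹ) → Decidable (Span v)
    span? v x = Dec.map′
      (λ (k , e) → decode k , e)
      (λ (s , e) → encode s , ≈ᴹ-trans e
        (combination-congˡ v (λ i → F.sym (decode-encode s i))))
      (any? (λ k → x ≟ᴹ combination (decode k) v))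

    Span-tail : ∀ {d} {v : Fin d → Carrierᴹ} {x y} → y ∈ Span v → y ∈ Span (x Vector.∷ v)
    Span-tail {v = v} {x} {y} (s , y≈) = 0# Vector.∷ s , (begin
      y                                 ≈⟨ y≈ ⟩
      combination s v                   ≈⟨ +ᴹ-identityˡ _ ⟨
      0ᴹ +ᴹ combination s v             ≈⟨ +ᴹ-congʳ (*ₗ-zeroˡ x) ⟨
      0# *ₗ x +ᴹ combination s v        ∎)

    Span-head : ∀ {d} {v : Fin d → Carrierᴹ} {x} → x ∈ Span (x Vector.∷ v)
    Span-head {d} {v} {x} = 1# Vector.∷ (λ _ → 0#) , (begin
      x                                     ≈⟨ +ᴹ-identityʳ x ⟨
      x +ᴹ 0ᴹ                               ≈⟨ +ᴹ-cong (*ₗ-identityˡ x) (≈ᴹ-trans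
        (Sum.sum-cong-≋ (λ i → *ₗ-zeroˡ (v i))) (Sum.sum-replicate-zero d)) ⟨
      1# *ₗ x +ᴹ combination (λ _ → 0#) v   ∎)

    Independent-∷ : ∀ {d} {v : Fin d → Carrierᴹ} {x} →
                    Independent v → x ∉ Span v → Independent (x Vector.∷ v)
    Independent-∷ {v = v} {x} ind x∉ s e = result
      where
      s′ = s ∘ suc
      rest = combination s′ v

      s₀≈0 : s zero ≈ 0#
      s₀≈0 with s zero ≟ 0#
      ... | yes p = p
      ... | no s₀≉0 with inverse (s zero) s₀≉0
      ...   | r , r*s₀≈1 = contradiction
        ((λ i → (F.- 1# F.* r) F.* s′ i) , (begin
          x                                       ≈⟨ inverseˡ-unique _ _ x+r*rest≈0 ⟩
          -ᴹ (r *ₗ rest)                          ≈⟨ -1* _ ⟨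
          (F.- 1#) *ₗ r *ₗ rest                   ≈⟨ *ₗ-assoc _ _ _ ⟨
          (F.- 1# F.* r) *ₗ rest                  ≈⟨ combination-* _ s′ v ⟨
          combination (λ i → (F.- 1# F.* r) F.* s′ i) v ∎)) x∉
        where
        x+r*rest≈0 : x +ᴹ r *ₗ rest ≈ᴹ 0ᴹ
        x+r*rest≈0 = begin
          x +ᴹ r *ₗ rest                   ≈⟨ +ᴹ-congʳ (*ₗ-identityˡ x) ⟨
          1# *ₗ x +ᴹ r *ₗ rest             ≈⟨ +ᴹ-congʳ (*ₗ-cong r*s₀≈1 ≈ᴹ-refl) ⟨
          (r F.* s zero) *ₗ x +ᴹ r *ₗ rest ≈⟨ +ᴹ-congʳ (*ₗ-assoc r (s zero) x) ⟩
          r *ₗ s zero *ₗ x +ᴹ r *ₗ rest    ≈⟨ *ₗ-distribˡ r _ _ ⟨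
          r *ₗ (s zero *ₗ x +ᴹ rest)       ≈⟨ *ₗ-cong F.refl e ⟩
          r *ₗ 0ᴹ                          ≈⟨ *ₗ-zeroʳ r ⟩
          0ᴹ                               ∎

      rest≈0 : rest ≈ᴹ 0ᴹ
      rest≈0 = begin
        rest                      ≈⟨ +ᴹ-identityˡ rest ⟨
        0ᴹ +ᴹ rest                ≈⟨ +ᴹ-congʳ (*ₗ-zeroˡ x) ⟨
        0# *ₗ x +ᴹ rest           ≈⟨ +ᴹ-congʳ (*ₗ-cong s₀≈0 ≈ᴹ-refl) ⟨
        s zero *ₗ x +ᴹ rest       ≈⟨ e ⟩
        0ᴹ                        ∎

      result : ∀ i → s i ≈ 0#
      result zero    = s₀≈0
      result (suc i) = ind s′ rest≈0 i

    vector : Fin (q ^ N) → Carrierᴹ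
    vector k = combination (decode k) b

    greedy : ∀ {p} (W : Subspace p) (ks : List (Fin (q ^ N))) →
             Σ[ d ∈ ℕ ] Σ[ v ∈ (Fin d → Carrierᴹ) ]
               (∀ i → v i ∈ ⟦ W ⟧) × Independent v ×
               All (λ k → vector k ∈ ⟦ W ⟧ → vector k ∈ Span v) ks
    greedy W [] = 0 , (λ ()) , (λ ()) , (λ _ _ ()) , []
    greedy W (k ∷ ks) with greedy W ks | Subspace.mem? W (vector k)
    ... | d , v , v∈W , ind , spans | no k∉W =
      d , v , v∈W , ind , (λ k∈W → contradiction k∈W k∉W) ∷ spans
    ... | d , v , v∈W , ind , spans | yes k∈W with span? v (vector k)
    ...   | yes k∈v = d , v , v∈W , ind , (λ _ → k∈v) ∷ spans
    ...   | no k∉v =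
      suc d , vector k Vector.∷ v , (λ { zero → k∈W ; (suc i) → v∈W i }) ,
      Independent-∷ ind k∉v ,
      (λ _ → Span-head) ∷ All.map (λ f k∈ → Span-tail (f k∈)) spans

  open BasisExistence using (greedy; coords; combination-congˡ; b;
      decode-encode; encode; Span-resp)

  -- dim is the length of some basis; the choice of basis is kept opaque, so only
  -- the type of this definition matters.
  abstract
    basis : ∀ {p} (W : Subspace p) →
            Σ[ d ∈ ℕ ] Σ[ v ∈ (Fin d → Carrierᴹ) ] IsBasis ⟦ W ⟧ v
    basis W with greedy W (allFin (q ^ N))
    ... | d , v , v∈W , ind , spans = d , v , record
      { members = v∈W
      ; independent = ind
      ; spanning = λ {x} x∈W →
          let s , x≈ = coords x
              x≈k = ≈ᴹ-trans x≈ (combination-congˡ b (λ i → F.sym (decode-encode s i)))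
          in Span-resp (≈ᴹ-sym x≈k)
               (All.lookup spans (∈-allFin (encode s)) (Subspace.resp W x≈k x∈W))
      }

  dim : ∀ {p} → Subspace p → ℕ
  dim W = proj₁ (basis W)

  -- X is finite, so a set of subspaces is given by a repetition-free
  -- enumeration; subspaces are compared as sets of vectors.
  record Collection p : Set (c ⊔ a ⊔ ℓa ⊔ lsuc p) where
    field
      size     : ℕ
      element  : Fin size → Subspace p
      distinct : ∀ {i j} → ⟦ element i ⟧ ≐ ⟦ element j ⟧ → i ≡ j

  open Collection public using (size; element)

  IsPartialSpread : ∀ {p} → ℕ → Collection p → Set (a ⊔ ℓa ⊔ p)
  IsPartialSpread m 𝒜 =
    (∀ i → dim (element 𝒜 i) ≡ m) ×
    (∀ {i j} → i ≢ j → ∀ {x} → x ∈ ⟦ element 𝒜 i ⊓ element 𝒜 j ⟧ → x ≈ᴹ 0ᴹ)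

  IsSpread : ∀ {p} → ℕ → Collection p → Set (a ⊔ ℓa ⊔ p)
  IsSpread m 𝒜 =
    IsPartialSpread m 𝒜 ×
    (∀ x → ¬ x ≈ᴹ 0ᴹ → ∃! _≡_ (λ i → x ∈ ⟦ element 𝒜 i ⟧))

  IsEvasive : ∀ {p p′} → Collection p → ℕ → Subspace p′ → Set
  IsEvasive 𝒜 h V = ∀ i → dim (V ⊓ element 𝒜 i) ≤ h

{-# OPTIONS --safe #-}

-- Everything is a count of vectors. The map (u , s) ↦ u + s has fibres of size
-- |U ∩ S|, so |U| |S| ≤ |X| |U ∩ S|, which is the dimension bound; if equality
-- holds then U + S = X for every S ∈ 𝒜. For h < m, choose x ∉ U. Each S then meets
-- the coset x + U in a coset of U ∩ S, that is in q ^ h vectors, and different S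
-- meet it in disjoint sets because 0 ∉ x + U. Hence |𝒜| q ^ h ≤ q ^ dim U.
-- In a spread the elements of 𝒜 cover X and 0 is covered more than once, so
-- q ^ (m * n) < |𝒜| q ^ m, which excludes |𝒜| ≤ q ^ (m * (n ∸ 1)).
module Submission where

open import Defs
open import Level using (_⊔_)
open import Algebra.Bundles using (CommutativeMonoid; CommutativeRing)
open import Algebra.Module.Bundles using (Module)
import Algebra.Properties.AbelianGroup as AbelianGroupProperties
import Algebra.Properties.CommutativeSemigroup as CommutativeSemigroupProperties
import Algebra.Properties.Ring as RingProperties
open import Data.Fin.Base using (Fin; zero; suc; fromℕ<; combine; finToFun; funToFin)
open import Data.Fin.Properties as Fin
  using (any?; ¬∀⟶∃¬; fromℕ<-injective; injective⇒≤; *↔×; funToFin-finToFin)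
open import Data.Nat.Base
  using (ℕ; zero; suc; _+_; _*_; _∸_; _^_; _≤_; _<_; z≤n; s≤s; NonZero; >-nonZero)
open import Data.Nat.Properties
  using (≤-reflexive; ≤-trans; ≤-antisym; <⇒≤; <⇒≤pred; ≮⇒≥; <-irrefl; ≤-<-trans; <-≤-trans
        ; m<m*n; m<n+m; ≤∧≢⇒<; +-identityʳ; +-comm; +-assoc; +-monoʳ-≤; +-monoʳ-<
        ; +-cancelˡ-≤; *-suc; *-zeroʳ; *-identityʳ; *-monoˡ-≤; *-cancelʳ-≤
        ; ^-monoʳ-<; ^-distribˡ-+-*; m^n≢0; module ≤-Reasoning)
open import Data.Product using (∃; ∃-syntax; _×_; _,_; proj₁; proj₂)
open import Data.Sum using (_⊎_; inj₁; inj₂)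
open import Data.Unit.Polymorphic.Base using (tt)
open import Function.Base using (_∘_)
open import Function.Bundles using (_↔_; Inverse; Injection)
open import Function.Definitions using (Injective)
open import Function.Construct.Identity using (↔-id)
open import Function.Construct.Symmetry using (↔-sym)
open import Function.Properties.Inverse using (↔⇒↣)
open import Relation.Binary.Core using (REL)
open import Relation.Binary.PropositionalEquality
  using (_≡_; _≢_; _≗_; refl; sym; trans; cong; cong₂; subst; subst₂)
open import Relation.Nullary.Decidable using (Dec; yes; no)
open import Relation.Nullary.Negation using (¬_; contradiction)
open import Relation.Unary using (Pred; _∈_; _∉_)
open import Relation.Unary.Polymorphic using (U)

-- Pigeonhole for relations between finite types.

module _ {a b r} {A : Set a} {B : Set b} (R : REL A B r)
         (total : ∀ x → ∃[ y ] R x y)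
         (leftUnique : ∀ {x x′ y} → R x y → R x′ y → x ≡ x′)
         {m n} (enumA : Fin m ↔ A) (enumB : Fin n ↔ B) where
  private
    f : Fin m → Fin n
    f = Inverse.from enumB ∘ proj₁ ∘ total ∘ Inverse.to enumA

    f-injective : Injective _≡_ _≡_ f
    f-injective eq = Injection.injective (↔⇒↣ enumA)
      (leftUnique (proj₂ (total _))
        (subst (R _) (Injection.injective (↔⇒↣ (↔-sym enumB)) (sym eq)) (proj₂ (total _))))

  -- The relations counted below are specified through `_≈ᴹ_`, so no map is given in advance:
  -- whichever images `total` picks, left uniqueness makes the choice injective.
  leftUnique⇒≤ : m ≤ n
  leftUnique⇒≤ = injective⇒≤ f-injective

  -- The missed `y` extends the injection by one value, placed at `zero`.
  leftUnique⇒< : ∀ {y} → (∀ x → ¬ R x y) → m < n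
  leftUnique⇒< {y} missed = injective⇒≤ g-injective
    where
    g : Fin (suc m) → Fin n
    g zero    = Inverse.from enumB y
    g (suc i) = f i

    missed′ : ∀ i → f i ≢ Inverse.from enumB y
    missed′ i eq = missed _
      (subst (R _) (Injection.injective (↔⇒↣ (↔-sym enumB)) eq) (proj₂ (total _)))

    g-injective : Injective _≡_ _≡_ g
    g-injective {zero}  {zero}  eq = refl
    g-injective {zero}  {suc j} eq = contradiction (sym eq) (missed′ j)
    g-injective {suc i} {zero}  eq = contradiction eq (missed′ i)
    g-injective {suc i} {suc j} eq = cong suc (f-injective eq)

funToFin-cong : ∀ {m n} {f g : Fin m → Fin n} → f ≗ g → funToFin f ≡ funToFin g
funToFin-cong {zero}  f≗g = refl
funToFin-cong {suc m} f≗g = cong₂ combine (f≗g zero) (funToFin-cong (f≗g ∘ suc))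

finToFun-injective : ∀ {m n} {j k : Fin (n ^ m)} → finToFun j ≗ finToFun {n} {m} k → j ≡ k
finToFun-injective {m} {n} {j} {k} eq = trans (sym (funToFin-finToFin {m} {n} j))
  (trans (funToFin-cong eq) (funToFin-finToFin {m} {n} k))

^-cancelˡ-≤ : ∀ {q} → 1 < q → ∀ {i j} → q ^ i ≤ q ^ j → i ≤ j
^-cancelˡ-≤ {q} 1<q le = ≮⇒≥ (λ j<i → <-irrefl refl (<-≤-trans (^-monoʳ-< q 1<q j<i) le))

-- The classes of 0 and 1 have different codes in `Fin q`. With this bound, an inequality between
-- powers of `q` yields one between exponents.
order>1 : ∀ {c ℓ} {F : CommutativeRing c ℓ} {q} → IsFiniteField F q → 1 < q
order>1 {F = F} {q} F-field = distinct⇒>1 (λ eq → 0≉1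
  (F.trans (F.sym (Inverse.inverseʳ order refl)) (Inverse.inverseʳ order (sym eq))))
  where
  module F = CommutativeRing F
  open IsFiniteField F-field
  distinct⇒>1 : ∀ {q} {i j : Fin q} → i ≢ j → 1 < q
  distinct⇒>1 {1} {zero} {zero} i≢j = contradiction refl i≢j
  distinct⇒>1 {suc (suc _)} _ = s≤s (s≤s z≤n)

-- Enumerating the vectors of a subspace.

module Counting {c ℓ a ℓa} {F : CommutativeRing c ℓ} {q : ℕ}
                (F-field : IsFiniteField F q)
                {X : Module F a ℓa} {N : ℕ} (X-dim : HasDimension X N) where
  private
    module F = CommutativeRing F
    1<q = order>1 F-field
  open Module X
  open LinearAlgebra X
  open IsFiniteField F-field
  open Subspaces F-field X-dim
  open BasisExistence
    using (0?; -1*; combination-+; combination-*; combination-congˡ; decode; encode; decode-encode)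
  open AbelianGroupProperties +ᴹ-abelianGroup
    using (∙-cancelˡ; ∙-cancelʳ; //-rightDividesʳ; inverseˡ-unique; xyx⁻¹≈y)
  open CommutativeSemigroupProperties
    (CommutativeMonoid.commutativeSemigroup +ᴹ-commutativeMonoid)
    using (xy∙z≈xz∙y; x∙yz≈xz∙y)
  open RingProperties F.ring using (-1*x≈-x)
  open AbelianGroupProperties F.+-abelianGroup using (x∙y⁻¹≈ε⇒x≈y)
  open import Relation.Binary.Reasoning.Setoid ≈ᴹ-setoid

  infixl 6 _-ᴹ_
  _-ᴹ_ : Carrierᴹ → Carrierᴹ → Carrierᴹ
  x -ᴹ y = x +ᴹ -ᴹ y

  -- Cardinality modulo `_≈ᴹ_`: `s` counts classes of vectors, while indices compare by `_≡_`, as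
  -- the pigeonhole lemmas require.
  record Enumeration {p} (W : Pred Carrierᴹ p) (s : ℕ) : Set (a ⊔ ℓa ⊔ p) where
    field
      at        : Fin s → Carrierᴹ
      member    : ∀ k → at k ∈ W
      injective : ∀ {j k} → at j ≈ᴹ at k → j ≡ k
      complete  : ∀ {x} → x ∈ W → ∃[ k ] at k ≈ᴹ x

  open Enumeration

  decode-injective : ∀ {d} {j k : Fin (q ^ d)} →
                     (∀ i → decode j i F.≈ decode k i) → j ≡ k
  decode-injective {d} eq = finToFun-injective {d} {q} (λ i →
    trans (sym (Inverse.inverseˡ order F.refl)) (Inverse.inverseˡ order (eq i)))

  combination-injective : ∀ {d} {v : Fin d → Carrierᴹ} → Independent v → ∀ {s t} →
                          combination s v ≈ᴹ combination t v → ∀ i → s i F.≈ t i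
  combination-injective {v = v} ind {s} {t} eq i = x∙y⁻¹≈ε⇒x≈y _ _
    (F.trans (F.+-congˡ (F.sym (-1*x≈-x (t i)))) (ind _ s-t≈0 i))
    where
    -- The negative of `t i` is written as `-1` times `t i`, so that `combination-*` applies.
    s-t≈0 : combination (λ i → s i F.+ F.- F.1# F.* t i) v ≈ᴹ 0ᴹ
    s-t≈0 = begin
      combination (λ i → s i F.+ F.- F.1# F.* t i) v
        ≈⟨ combination-+ s (λ i → F.- F.1# F.* t i) v ⟩
      combination s v +ᴹ combination (λ i → F.- F.1# F.* t i) v
        ≈⟨ +ᴹ-cong eq (≈ᴹ-trans (combination-* (F.- F.1#) t v) (-1* _)) ⟩
      combination t v -ᴹ combination t v
        ≈⟨ -ᴹ‿inverseʳ _ ⟩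
      0ᴹ ∎

  -- Vectors correspond to coordinate tuples, and `Fin (q ^ d)` encodes these. With `W` a bare
  -- predicate, the whole space is covered too.
  basis-enumeration : ∀ {p} {W : Pred Carrierᴹ p} {d} {v : Fin d → Carrierᴹ} →
                      (∀ s → combination s v ∈ W) → IsBasis W v → Enumeration W (q ^ d)
  basis-enumeration {v = v} closed B = record
    { at        = λ k → combination (decode k) v
    ; member    = λ k → closed (decode k)
    ; injective = λ eq → decode-injective (combination-injective independent eq)
    ; complete  = λ x∈W → let s , x≈ = spanning x∈W in
        encode s , ≈ᴹ-trans (combination-congˡ v (decode-encode s)) (≈ᴹ-sym x≈)
    }
    where open IsBasis B

  abstract
    space : Enumeration (U {ℓ = a}) (q ^ N)
    space = basis-enumeration (λ _ → tt) (proj₂ X-dim)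

  module _ {p} (W : Subspace p) where
    open Subspace W using (resp; 0-closed; +-closed; *-closed)

    combination-closed : ∀ {d} {v : Fin d → Carrierᴹ} → (∀ i → v i ∈ ⟦ W ⟧) →
                         ∀ s → combination s v ∈ ⟦ W ⟧
    combination-closed {zero}  v∈W s = 0-closed
    combination-closed {suc d} v∈W s =
      +-closed (*-closed (s zero) (v∈W zero)) (combination-closed (v∈W ∘ suc) (s ∘ suc))

    -ᴹ-closed : ∀ {x} → x ∈ ⟦ W ⟧ → -ᴹ x ∈ ⟦ W ⟧
    -ᴹ-closed x∈W = resp (-1* _) (*-closed (F.- F.1#) x∈W)

    abstract
      elements : Enumeration ⟦ W ⟧ (q ^ dim W)
      elements = let _ , _ , B = basis W in
        basis-enumeration (combination-closed (IsBasis.members B)) B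

    zero⇒dim≤0 : (∀ {x} → x ∈ ⟦ W ⟧ → x ≈ᴹ 0ᴹ) → dim W ≤ 0
    -- The 1 is `q ^ 0`: all listed vectors are 0, so even a constant map is injective on indices.
    zero⇒dim≤0 W≈0 = ^-cancelˡ-≤ 1<q (injective⇒≤ {n = 1} {f = λ _ → zero} (λ _ →
      injective elements (≈ᴹ-trans (W≈0 (member elements _)) (≈ᴹ-sym (W≈0 (member elements _))))))

    abstract
      -- Otherwise all `q ^ N` vectors of the space inject into `W`. Since membership is decidable,
      -- a finite search turns this refutation into a witness.
      dim<N⇒∃∉ : dim W < N → ∃[ x ] x ∉ ⟦ W ⟧
      dim<N⇒∃∉ dim<N =
        let k , k∉W = ¬∀⟶∃¬ (q ^ N) (λ k → at space k ∈ ⟦ W ⟧) (Subspace.mem? W ∘ at space) ¬all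
        in at space k , k∉W
        where
        ¬all : ¬ (∀ k → at space k ∈ ⟦ W ⟧)
        ¬all all∈W = <-irrefl refl (<-≤-trans dim<N (^-cancelˡ-≤ 1<q
          (leftUnique⇒≤ (λ j k → at elements k ≈ᴹ at space j) (complete elements ∘ all∈W)
            (λ e e′ → injective space (≈ᴹ-trans (≈ᴹ-sym e) e′)) (↔-id _) (↔-id _))))

  -- Sums and intersections of two subspaces.

  module _ {p p′} (V : Subspace p) (W : Subspace p′) where
    private
      module V = Subspace V
      module W = Subspace W
      Eⱽ = elements V
      Eᵂ = elements W
      E⊓ = elements (V ⊓ W)

    -- Naming only the summand in `V` makes membership a finite search through `elements V`.
    Sum : Pred Carrierᴹ _
    Sum x = ∃[ v ] v ∈ ⟦ V ⟧ × (x -ᴹ v) ∈ ⟦ W ⟧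

    private
      Summand : Carrierᴹ → Fin (q ^ dim V) → Set _
      Summand x j = (x -ᴹ at Eⱽ j) ∈ ⟦ W ⟧

      summand? : ∀ x → Dec (∃ (Summand x))
      summand? x = any? (λ j → W.mem? (x -ᴹ at Eⱽ j))

      -- The value at k outside V + W is irrelevant.
      summand : Fin (q ^ N) → Carrierᴹ
      summand k with summand? (at space k)
      ... | yes (j , _) = at Eⱽ j
      ... | no _        = 0ᴹ

      summand-correct : ∀ k {j} → Summand (at space k) j →
                        summand k ∈ ⟦ V ⟧ × (at space k -ᴹ summand k) ∈ ⟦ W ⟧
      summand-correct k s with summand? (at space k)
      ... | yes (j , s′) = member Eⱽ j , s′
      ... | no ¬s        = contradiction (_ , s) ¬s

      Pairs = Fin (q ^ dim V) × Fin (q ^ dim W)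

      -- A pair (v, w) is encoded by its sum and by the offset of v from the summand chosen for that
      -- sum. The offset lies in `V ⊓ W`; sum and offset together recover v, and then w.
      R : Pairs → Fin (q ^ N) × Fin (q ^ dim (V ⊓ W)) → Set _
      R (j , l) (k , t) = at space k ≈ᴹ at Eⱽ j +ᴹ at Eᵂ l
                        × at E⊓ t ≈ᴹ at Eⱽ j -ᴹ summand k

      R-total : ∀ x → ∃ (R x)
      R-total (j , l) with complete space {at Eⱽ j +ᴹ at Eᵂ l} tt
      ... | k , k≈ = let t , t≈ = complete E⊓ (∈V , ∈W) in (k , t) , k≈ , t≈
        where
        v = at Eⱽ j
        w = at Eᵂ l
        -- The search at `k` succeeds because v itself is a solution: the vector at `k` minus v is
        -- w.
        correct = summand-correct k {j}
          (W.resp (≈ᴹ-trans (≈ᴹ-sym (xyx⁻¹≈y v w)) (+ᴹ-congʳ (≈ᴹ-sym k≈))) (member Eᵂ l))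
        ∈V = V.+-closed (member Eⱽ j) (-ᴹ-closed V (proj₁ correct))
        -- The offset is also the chosen `W`-part of the sum with w subtracted.
        ∈W = W.resp (begin
          at space k -ᴹ summand k -ᴹ w   ≈⟨ +ᴹ-congʳ (+ᴹ-congʳ k≈) ⟩
          v +ᴹ w -ᴹ summand k -ᴹ w       ≈⟨ +ᴹ-congʳ (xy∙z≈xz∙y v w _) ⟩
          v -ᴹ summand k +ᴹ w -ᴹ w       ≈⟨ //-rightDividesʳ w _ ⟩
          v -ᴹ summand k                 ∎)
          (W.+-closed (proj₂ correct) (-ᴹ-closed W (member Eᵂ l)))

      R-leftUnique : ∀ {x x′ y} → R x y → R x′ y → x ≡ x′
      R-leftUnique {j , l} {j′ , l′} (k≈ , t≈) (k≈′ , t≈′) =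
        cong₂ _,_ j≡j′ (injective Eᵂ (∙-cancelˡ (at Eⱽ j) _ _ (begin
          at Eⱽ j +ᴹ at Eᵂ l     ≈⟨ k≈ ⟨
          at space _             ≈⟨ k≈′ ⟩
          at Eⱽ j′ +ᴹ at Eᵂ l′   ≡⟨ cong (λ i → at Eⱽ i +ᴹ at Eᵂ l′) j≡j′ ⟨
          at Eⱽ j +ᴹ at Eᵂ l′    ∎)))
        where
        j≡j′ : j ≡ j′
        j≡j′ = injective Eⱽ (∙-cancelʳ _ _ _ (≈ᴹ-trans (≈ᴹ-sym t≈) t≈′))

    -- Grassmann's formula with `N` in place of the dimension of V + W, read off from the exponents
    -- of the count.
    dim-⊓ : dim V + dim W ≤ N + dim (V ⊓ W)
    dim-⊓ = ^-cancelˡ-≤ 1<q (subst₂ _≤_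
      (sym (^-distribˡ-+-* q (dim V) (dim W))) (sym (^-distribˡ-+-* q N (dim (V ⊓ W))))
      (leftUnique⇒≤ R R-total R-leftUnique *↔× *↔×))

    -- If `x` were outside the sum, every code with first component `x` would be missed and the
    -- count would be strict. The vector 0 supplies a second component for such a code.
    dim-⊓-equality : dim V + dim W ≡ N + dim (V ⊓ W) → ∀ x → x ∈ Sum
    dim-⊓-equality eq x with complete space {x} tt
    ... | k , k≈ with summand? (at space k)
    ...   | yes (j , s) = at Eⱽ j , member Eⱽ j , W.resp (+ᴹ-congʳ k≈) s
    ...   | no ¬s = contradiction
      (leftUnique⇒< R R-total R-leftUnique *↔× *↔×
        {k , proj₁ (complete E⊓ (Subspace.0-closed (V ⊓ W)))}
        (λ (j , l) (k≈′ , _) → ¬s (j , W.resp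
          (≈ᴹ-trans (≈ᴹ-sym (xyx⁻¹≈y _ _)) (+ᴹ-congʳ (≈ᴹ-sym k≈′))) (member Eᵂ l))))
      (<-irrefl (trans (sym (^-distribˡ-+-* q (dim V) (dim W)))
        (trans (cong (q ^_) eq) (^-distribˡ-+-* q N (dim (V ⊓ W))))))

  -- Counting over a whole collection.

  -- Each S in 𝒜 meets the coset x + V, and does so in a coset of V ⊓ S.
  coset-bound : ∀ {p p′} (𝒜 : Collection p) (V : Subspace p′) {h} →
                (∀ {i j} → i ≢ j → ∀ {x} → x ∈ ⟦ element 𝒜 i ⊓ element 𝒜 j ⟧ → x ≈ᴹ 0ᴹ) →
                (∀ i → dim (V ⊓ element 𝒜 i) ≡ h) →
                ∀ {x} → x ∉ ⟦ V ⟧ → (∀ i → x ∈ Sum V (element 𝒜 i)) →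
                size 𝒜 * q ^ h ≤ q ^ dim V
  coset-bound 𝒜 V {h} disjoint dim≡h {x} x∉V meets =
    leftUnique⇒≤ R R-total R-leftUnique *↔× (↔-id _)
    where
    module V = Subspace V
    module S i = Subspace (element 𝒜 i)

    E : ∀ i → Enumeration ⟦ V ⊓ element 𝒜 i ⟧ (q ^ h)
    E i = subst (λ d → Enumeration _ (q ^ d)) (dim≡h i) (elements (V ⊓ element 𝒜 i))

    v : ∀ i → Carrierᴹ
    v i = proj₁ (meets i)

    -- As `x -ᴹ v i` lies in the i-th member S, the part of the coset inside S is `x -ᴹ v i` plus V
    -- ∩ S. Subtracting `x` names its points by vectors of `V`.
    R : Fin (size 𝒜) × Fin (q ^ h) → Fin (q ^ dim V) → Set _
    R (i , t) k = at (elements V) k ≈ᴹ at (E i) t -ᴹ v i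

    R-total : ∀ y → ∃ (R y)
    R-total (i , t) = complete (elements V)
      (V.+-closed (proj₁ (member (E i) t)) (-ᴹ-closed V (proj₁ (proj₂ (meets i)))))

    ∈S : ∀ {i t k} → R (i , t) k → (x +ᴹ at (elements V) k) ∈ ⟦ element 𝒜 i ⟧
    ∈S {i} {t} {k} k≈ = S.resp i (begin
      x -ᴹ v i +ᴹ at (E i) t       ≈⟨ x∙yz≈xz∙y x _ _ ⟨
      x +ᴹ (at (E i) t -ᴹ v i)     ≈⟨ +ᴹ-congˡ k≈ ⟨
      x +ᴹ at (elements V) k       ∎)
      (S.+-closed i (proj₂ (proj₂ (meets i))) (proj₂ (member (E i) t)))

    R-leftUnique : ∀ {y y′ k} → R y k → R y′ k → y ≡ y′
    R-leftUnique {i , t} {i′ , t′} {k} k≈ k≈′ with i Fin.≟ i′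
    ... | yes refl = cong (i ,_) (injective (E i) (∙-cancelʳ _ _ _ (≈ᴹ-trans (≈ᴹ-sym k≈) k≈′)))
    -- A coset point in two different members is 0, which would put `x` into `V`.
    ... | no i≢i′ = contradiction
      (V.resp (≈ᴹ-sym (inverseˡ-unique _ _
          (disjoint i≢i′ (∈S {i} {t} {k} k≈ , ∈S {i′} {t′} {k} k≈′))))
        (-ᴹ-closed V (member (elements V) k)))
      x∉V

  -- Each vector is labelled by a member containing it and its index there. The second half of `R`
  -- reserves 0 for `i₀`, so the label of 0 in `i₁` is missed and the count is strict.
  cover-bound : ∀ {p} (𝒜 : Collection p) {m} → (∀ i → dim (element 𝒜 i) ≡ m) →
                (∀ x → ¬ x ≈ᴹ 0ᴹ → ∃[ i ] x ∈ ⟦ element 𝒜 i ⟧) →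
                ∀ {i₀ i₁ : Fin (size 𝒜)} → i₀ ≢ i₁ →
                q ^ N < size 𝒜 * q ^ m
  cover-bound 𝒜 {m} dim≡m covers {i₀} {i₁} i₀≢i₁ =
    leftUnique⇒< R R-total R-leftUnique (↔-id _) *↔× {i₁ , proj₁ zero₁}
      (λ k (k≈ , 0⇒i₀) → i₀≢i₁ (sym (0⇒i₀ (≈ᴹ-trans (≈ᴹ-sym k≈) (proj₂ zero₁)))))
    where
    E : ∀ i → Enumeration ⟦ element 𝒜 i ⟧ (q ^ m)
    E i = subst (λ d → Enumeration _ (q ^ d)) (dim≡m i) (elements (element 𝒜 i))

    zeroAt : ∀ i → ∃[ t ] at (E i) t ≈ᴹ 0ᴹ
    zeroAt i = complete (E i) (Subspace.0-closed (element 𝒜 i))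

    zero₁ = zeroAt i₁

    R : Fin (q ^ N) → Fin (size 𝒜) × Fin (q ^ m) → Set _
    R k (i , t) = at (E i) t ≈ᴹ at space k × (at space k ≈ᴹ 0ᴹ → i ≡ i₀)

    R-total : ∀ k → ∃ (R k)
    R-total k with 0? (at space k)
    ... | yes k≈0 = let t , t≈ = zeroAt i₀ in
      (i₀ , t) , ≈ᴹ-trans t≈ (≈ᴹ-sym k≈0) , λ _ → refl
    ... | no k≉0 = let i , k∈ = covers _ k≉0 ; t , t≈ = complete (E i) k∈ in
      (i , t) , t≈ , λ k≈0 → contradiction k≈0 k≉0

    R-leftUnique : ∀ {k k′ y} → R k y → R k′ y → k ≡ k′
    R-leftUnique (k≈ , _) (k≈′ , _) = injective space (≈ᴹ-trans (≈ᴹ-sym k≈) k≈′)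

-- Bounds for evasive subspaces, with `suc n` as the n of the theorem.

module _ {c ℓ a ℓa} {q m n : ℕ}
         {F : CommutativeRing c ℓ} (F-field : IsFiniteField F q)
         {X : Module F a ℓa} (X-dim : HasDimension X (m * suc n)) where
  open Subspaces F-field X-dim
  open Counting F-field X-dim
  open Module X using (Carrierᴹ; _≈ᴹ_; 0ᴹ)

  module Evasive {p p′} (1≤m : 1 ≤ m) (𝒜 : Collection p) (i₀ : Fin (size 𝒜))
                 (spread : IsPartialSpread m 𝒜)
                 {h : ℕ} (V : Subspace p′) (evasive : IsEvasive 𝒜 h V) where
    private
      1<q = order>1 F-field

      instance
        q≢0 : NonZero q
        q≢0 = >-nonZero (<⇒≤ 1<q)

      m*[1+n]≡ : m * suc n ≡ m * n + m
      m*[1+n]≡ = trans (*-suc m n) (+-comm m (m * n))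

      m+[m*n+e]≡ : ∀ e → m + (m * n + e) ≡ m * suc n + e
      m+[m*n+e]≡ e = trans (sym (+-assoc m (m * n) e)) (cong (_+ e) (sym (*-suc m n)))

    dim≤m*n+dim-⊓ : ∀ i → dim V ≤ m * n + dim (V ⊓ element 𝒜 i)
    dim≤m*n+dim-⊓ i = +-cancelˡ-≤ m _ _ (begin
      m + dim V                               ≡⟨ +-comm m (dim V) ⟩
      dim V + m                               ≡⟨ cong (dim V +_) (proj₁ spread i) ⟨
      dim V + dim (element 𝒜 i)               ≤⟨ dim-⊓ V (element 𝒜 i) ⟩
      m * suc n + dim (V ⊓ element 𝒜 i)       ≡⟨ m+[m*n+e]≡ _ ⟨
      m + (m * n + dim (V ⊓ element 𝒜 i))     ∎)
      where open ≤-Reasoning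

    -- Evasiveness is vacuous on an empty collection; the member `i₀` gives it content.
    dim-bound : dim V ≤ m * n + h
    dim-bound = ≤-trans (dim≤m*n+dim-⊓ i₀) (+-monoʳ-≤ (m * n) (evasive i₀))

    -- Equality leaves no slack: each intersection has dimension exactly `h`, and `dim-⊓` is sharp
    -- for every member, which gives `coset-bound` its hypotheses.
    size-bound : h < m → dim V ≡ m * n + h → size 𝒜 ≤ q ^ (m * n)
    size-bound h<m dim≡ = *-cancelʳ-≤ _ _ (q ^ h) {{m^n≢0 q h}} (subst (size 𝒜 * q ^ h ≤_)
      (trans (cong (q ^_) dim≡) (^-distribˡ-+-* q (m * n) h))
      (coset-bound 𝒜 V (proj₂ spread) dim⊓≡h (proj₂ outside)
        (λ i → dim-⊓-equality V (element 𝒜 i) (dim-eq i) (proj₁ outside))))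
      where
      dim⊓≡h : ∀ i → dim (V ⊓ element 𝒜 i) ≡ h
      dim⊓≡h i = ≤-antisym (evasive i)
        (+-cancelˡ-≤ (m * n) _ _ (≤-trans (≤-reflexive (sym dim≡)) (dim≤m*n+dim-⊓ i)))

      dim-eq : ∀ i → dim V + dim (element 𝒜 i) ≡ m * suc n + dim (V ⊓ element 𝒜 i)
      dim-eq i = trans (cong₂ _+_ dim≡ (proj₁ spread i)) (trans (+-comm _ m)
        (trans (m+[m*n+e]≡ h) (cong (m * suc n +_) (sym (dim⊓≡h i)))))

      -- Here `h < m` enters: it makes `V` a proper subspace.
      outside = dim<N⇒∃∉ V (subst₂ _<_ (sym dim≡) (sym m*[1+n]≡) (+-monoʳ-< (m * n) h<m))

    -- Equality would make `size-bound` contradict the strict covering count. That count needs two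
    -- members, which exist because `1 ≤ n` makes the space larger than one member.
    spread-bound : h < m → 1 ≤ n → IsSpread m 𝒜 → dim V ≤ m * n + h ∸ 1
    spread-bound h<m 1≤n (_ , cover) = <⇒≤pred (≤∧≢⇒< dim-bound (λ dim≡ →
      <-irrefl refl (begin-strict
        q ^ (m * suc n)        <⟨ cover-bound 𝒜 (proj₁ spread) covers i₀≢i₁ ⟩
        size 𝒜 * q ^ m         ≤⟨ *-monoˡ-≤ (q ^ m) (size-bound h<m dim≡) ⟩
        q ^ (m * n) * q ^ m    ≡⟨ ^-distribˡ-+-* q (m * n) m ⟨
        q ^ (m * n + m)        ≡⟨ cong (q ^_) m*[1+n]≡ ⟨
        q ^ (m * suc n)        ∎)))
      where
      open ≤-Reasoning
      covers : ∀ x → ¬ x ≈ᴹ 0ᴹ → ∃[ i ] x ∈ ⟦ element 𝒜 i ⟧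
      covers x x≉0 = let i , x∈ , _ = cover x x≉0 in i , x∈

      m<m*[1+n] : m < m * suc n
      m<m*[1+n] = m<m*n m (suc n) {{>-nonZero 1≤m}} (s≤s 1≤n)

      outside : ∃[ x ] x ∉ ⟦ element 𝒜 i₀ ⟧
      outside = dim<N⇒∃∉ (element 𝒜 i₀)
        (≤-<-trans (≤-reflexive (proj₁ spread i₀)) m<m*[1+n])

      -- A vector outside the member `i₀` is non-zero, so it is covered, necessarily by another
      -- member.
      cover₁ = covers (proj₁ outside) (λ x≈0 → proj₂ outside
        (Subspace.resp (element 𝒜 i₀) (Module.≈ᴹ-sym X x≈0) (Subspace.0-closed (element 𝒜 i₀))))

      i₀≢i₁ : i₀ ≢ proj₁ cover₁
      i₀≢i₁ eq = proj₂ outside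
        (subst (λ i → proj₁ outside ∈ ⟦ element 𝒜 i ⟧) (sym eq) (proj₂ cover₁))

  -- The intersection has dimension 0 in `dim-⊓`. For n = 1 this rules out a second member.
  disjoint⇒2m≤dim : ∀ {p} (𝒜 : Collection p) → IsPartialSpread m 𝒜 →
                    ∀ {i j} → i ≢ j → m + m ≤ m * suc n
  disjoint⇒2m≤dim 𝒜 (dim≡m , disjoint) {i} {j} i≢j = begin
    m + m                                              ≡⟨ cong₂ _+_ (dim≡m i) (dim≡m j) ⟨
    dim (element 𝒜 i) + dim (element 𝒜 j)              ≤⟨ dim-⊓ (element 𝒜 i) (element 𝒜 j) ⟩
    m * suc n + dim (element 𝒜 i ⊓ element 𝒜 j)        ≤⟨ +-monoʳ-≤ (m * suc n)
      (zero⇒dim≤0 (element 𝒜 i ⊓ element 𝒜 j) (disjoint i≢j)) ⟩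
    m * suc n + 0                                      ≡⟨ +-identityʳ _ ⟩
    m * suc n                                          ∎
    where open ≤-Reasoning

theorem3p1 : ∀ {c ℓ a ℓa p p′} (q m n : ℕ) →
    IsPrimePower q → 1 ≤ m → 1 ≤ n → 2 ≤ m * n →
    (F : CommutativeRing c ℓ) (F-field : IsFiniteField F q)
    (X : Module F a ℓa) (X-dim : HasDimension X (m * n)) →
    let open Subspaces F-field X-dim in
    (𝒜 : Collection p) → 1 ≤ size 𝒜 → IsPartialSpread m 𝒜 →
    (h : ℕ) → 1 ≤ h → h ≤ m →
    (U : Subspace p′) → IsEvasive 𝒜 h U →
    dim U ≤ m * (n ∸ 1) + h
    × (h < m ⊎ n ≡ 1 → dim U ≡ m * (n ∸ 1) + h → size 𝒜 ≤ q ^ (m * (n ∸ 1)))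
    × (h < m → 2 ≤ n → IsSpread m 𝒜 → dim U ≤ m * (n ∸ 1) + h ∸ 1)
theorem3p1 q m (suc n) _ 1≤m _ _ F F-field X X-dim 𝒜 1≤size spread h _ _ V evasive =
  dim-bound ,
  (λ { (inj₁ h<m) → size-bound h<m
     -- The space has dimension `m` here, so two members would force `m + m ≤ m`. Hence the size is
     -- at most 1, which is `q ^ (m * 0)`; this also settles h = m.
     ; (inj₂ refl) _ → subst (λ d → size 𝒜 ≤ q ^ d) (sym (*-zeroʳ m))
         (≮⇒≥ (λ 1<size → <-irrefl refl (<-≤-trans (m<n+m m 1≤m) (subst (m + m ≤_) (*-identityʳ m)
           (disjoint⇒2m≤dim F-field X-dim 𝒜 spread
             (λ eq → contradiction (fromℕ<-injective 0 1 1≤size 1<size eq) λ ())))))) }) ,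
  (λ h<m → λ { (s≤s 1≤n) → spread-bound h<m 1≤n })
  where
  open Subspaces F-field X-dim
  open Evasive F-field X-dim 1≤m 𝒜 (fromℕ< 1≤size) spread V evasive
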